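{- The class of $\{\to\}$-subreducts of subresiduated lattices (viewed as algebras $(A,\to,1)$ of type $(2,0)$) is not a variety.
   Context: A subresiduated lattice is an algebra $(A,\wedge,\vee,\to,0,1)$ of type $(2,2,2,0,0)$ such that $(A,\wedge,\vee,0,1)$ is a bounded distributive lattice and for all $x,y,z\in A$: $x\to x=1$; $x\to y\le z\to(x\to y)$; $x\wedge(x\to y)\le y$; $z\to(x\wedge y)=(z\to x)\wedge(z\to y)$; $(x\vee y)\to z=(x\to z)\wedge(y\to z)$; $(x\to y)\wedge(y\to z)\le x\to z$. A $\{\to\}$-subreduct of a subresiduated lattice $A$ is any isomorphic image of a (nonempty) subalgebra of the reduct $(A,\to)$. Since $1=x\to x$, such a subalgebra always contains $1$, so it is viewed as an algebra of type $(2,0)$ with operations $\to,1$. -}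

module Defs where

open import Level using (Level; suc; _⊔_)
open import Algebra.Bundles.Raw using (RawMonoid)
open import Algebra.Core using (Op₂)
import Algebra.Definitions
import Algebra.Lattice.Structures
open import Algebra.Morphism.Structures using (module MonoidMorphisms)
open import Algebra.Structures using (IsMagma)
open import Data.Product using (Σ; ∃; _×_; _,_; proj₁; proj₂)
open import Function.Definitions using (Surjective)
open import Relation.Binary.Core using (Rel)
open import Relation.Binary.Definitions using (_Respects_)
open import Relation.Unary using (Pred)

-- Algebras are setoid-based, as in the standard library, and everything lives
-- in one arbitrary universe ℓ: "set" means "type in Set ℓ".

------------------------------------------------------------------------
-- Algebras of type (2,0)

record Algebra⟨2,0⟩ (ℓ : Level) : Set (suc ℓ) where
  infixr 6 _⇒_
  infix  4 _≈_
  field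
    Carrier : Set ℓ
    _≈_     : Rel Carrier ℓ
    _⇒_     : Op₂ Carrier
    𝟙       : Carrier
    isMagma : IsMagma _≈_ _⇒_

  open IsMagma isMagma public
    using (isEquivalence; setoid)
    renaming (∙-cong to ⇒-cong)

  -- A RawMonoid carries no laws: it is exactly the type-(2,0) signature, so
  -- the library's monoid morphisms are the morphisms of type-(2,0) algebras.
  rawMonoid : RawMonoid ℓ ℓ
  rawMonoid = record { Carrier = Carrier ; _≈_ = _≈_ ; _∙_ = _⇒_ ; ε = 𝟙 }

module _ {ℓ : Level} (A B : Algebra⟨2,0⟩ ℓ) where
  private
    module A = Algebra⟨2,0⟩ A
    module B = Algebra⟨2,0⟩ B
  open MonoidMorphisms A.rawMonoid B.rawMonoid

  HomomorphicImage : Set ℓ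
  HomomorphicImage = Σ (A.Carrier → B.Carrier) λ f →
    IsMonoidHomomorphism f × Surjective A._≈_ B._≈_ f

  Isomorphic : Set ℓ
  Isomorphic = ∃ IsMonoidIsomorphism

record Subuniverse {ℓ} (A : Algebra⟨2,0⟩ ℓ) : Set (suc ℓ) where
  open Algebra⟨2,0⟩ A
  field
    member   : Pred Carrier ℓ
    resp     : member Respects _≈_
    ⇒-closed : ∀ {x y} → member x → member y → member (x ⇒ y)
    𝟙-closed : member 𝟙

subalgebra : ∀ {ℓ} (A : Algebra⟨2,0⟩ ℓ) → Subuniverse A → Algebra⟨2,0⟩ ℓ
subalgebra A S = record
  { Carrier = Σ Carrier member
  ; _≈_     = λ x y → proj₁ x ≈ proj₁ y
  ; _⇒_     = λ x y → (proj₁ x ⇒ proj₁ y) , ⇒-closed (proj₂ x) (proj₂ y)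
  ; 𝟙       = 𝟙 , 𝟙-closed
  ; isMagma = record
    { isEquivalence = record { refl = refl ; sym = sym ; trans = trans }
    ; ∙-cong        = ⇒-cong
    }
  }
  where
  open Algebra⟨2,0⟩ A
  open Subuniverse S
  open IsMagma isMagma using (refl; sym; trans)

product : ∀ {ℓ} (I : Set ℓ) → (I → Algebra⟨2,0⟩ ℓ) → Algebra⟨2,0⟩ ℓ
product I A = record
  { Carrier = ∀ i → Carrier (A i)
  ; _≈_     = λ x y → ∀ i → _≈_ (A i) (x i) (y i)
  ; _⇒_     = λ x y i → _⇒_ (A i) (x i) (y i)
  ; 𝟙       = λ i → 𝟙 (A i)
  ; isMagma = record
    { isEquivalence = record
      { refl  = λ i → IsMagma.refl (isMagma (A i))
      ; sym   = λ p i → IsMagma.sym (isMagma (A i)) (p i)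
      ; trans = λ p q i → IsMagma.trans (isMagma (A i)) (p i) (q i)
      }
    ; ∙-cong = λ p q i → ⇒-cong (A i) (p i) (q i)
    }
  }
  where open Algebra⟨2,0⟩

-- Closure under isomorphism is an instance of H-closed, and nonemptiness of
-- the class follows from P-closed at the empty family.
record IsVariety {ℓ k} (K : Pred (Algebra⟨2,0⟩ ℓ) k) : Set (suc ℓ ⊔ k) where
  field
    H-closed : ∀ {A B} → HomomorphicImage A B → K A → K B
    S-closed : ∀ {A} (S : Subuniverse A) → K A → K (subalgebra A S)
    P-closed : ∀ (I : Set ℓ) (A : I → Algebra⟨2,0⟩ ℓ) →
               (∀ i → K (A i)) → K (product I A)

------------------------------------------------------------------------
-- Subresiduated lattices

record SubresiduatedLattice (ℓ : Level) : Set (suc ℓ) where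
  infixr 7 _∧_
  infixr 6 _∨_
  infixr 5 _⇒_
  infix  4 _≈_ _≤_
  field
    Carrier : Set ℓ
    _≈_     : Rel Carrier ℓ
    _∧_     : Op₂ Carrier
    _∨_     : Op₂ Carrier
    _⇒_     : Op₂ Carrier
    𝟘       : Carrier
    𝟙       : Carrier

  open Algebra.Definitions _≈_
  open Algebra.Lattice.Structures _≈_

  -- The lattice order, as in Algebra.Lattice.Properties.Lattice.
  _≤_ : Rel Carrier ℓ
  x ≤ y = x ≈ x ∧ y

  field
    isDistributiveLattice : IsDistributiveLattice _∨_ _∧_
    ∨-identity            : Identity 𝟘 _∨_
    ∧-identity            : Identity 𝟙 _∧_
    ⇒-cong                : Congruent₂ _⇒_
    x⇒x≈𝟙                 : ∀ x → x ⇒ x ≈ 𝟙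
    x⇒y≤z⇒[x⇒y]           : ∀ x y z → x ⇒ y ≤ z ⇒ (x ⇒ y)
    x∧[x⇒y]≤y             : ∀ x y → x ∧ (x ⇒ y) ≤ y
    ⇒-distribˡ-∧          : ∀ x y z → z ⇒ (x ∧ y) ≈ (z ⇒ x) ∧ (z ⇒ y)
    ⇒-distribʳ-∨          : ∀ x y z → (x ∨ y) ⇒ z ≈ (x ⇒ z) ∧ (y ⇒ z)
    ⇒-trans               : ∀ x y z → (x ⇒ y) ∧ (y ⇒ z) ≤ x ⇒ z

  open IsDistributiveLattice isDistributiveLattice public
    using (isEquivalence; refl; sym; trans)

  ⇒-reduct : Algebra⟨2,0⟩ ℓ
  ⇒-reduct = record
    { Carrier = Carrier
    ; _≈_     = _≈_
    ; _⇒_     = _⇒_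
    ; 𝟙       = 𝟙
    ; isMagma = record { isEquivalence = isEquivalence ; ∙-cong = ⇒-cong }
    }

------------------------------------------------------------------------
-- {→}-subreducts

-- The universe of a nonempty subalgebra of (L, →); 𝟙 is not assumed to belong.
record ⇒-Subuniverse {ℓ} (L : SubresiduatedLattice ℓ) : Set (suc ℓ) where
  open SubresiduatedLattice L
  field
    member   : Pred Carrier ℓ
    resp     : member Respects _≈_
    nonempty : ∃ member
    ⇒-closed : ∀ {x y} → member x → member y → member (x ⇒ y)

  subuniverse : Subuniverse ⇒-reduct
  subuniverse = record
    { member   = member
    ; resp     = resp
    ; ⇒-closed = ⇒-closed
    ; 𝟙-closed = let (x , x∈) = nonempty in resp (x⇒x≈𝟙 x) (⇒-closed x∈ x∈)
    }

IsSubreduct : ∀ {ℓ} → Pred (Algebra⟨2,0⟩ ℓ) (suc ℓ)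
IsSubreduct {ℓ} A =
  Σ (SubresiduatedLattice ℓ) λ L → Σ (⇒-Subuniverse L) λ S →
    Isomorphic (subalgebra (SubresiduatedLattice.⇒-reduct L)
                           (⇒-Subuniverse.subuniverse S))
               A

-- In a subresiduated lattice x ⇒ y ≈ 𝟙 forces x ≤ y, so every subreduct
-- satisfies the quasi-identity  x ⇒ y ≈ 𝟙 ≈ y ⇒ x  implies  x ≈ y.  On the chain
-- bot < mid < top let x ⇒ y be top if x ≤ y and bot otherwise.  Since ⇒ takes
-- only the values bot and top, identifying these two is a congruence of the
-- reduct; in the quotient ⇒ is constantly 𝟙 although there are two elements,
-- so the quasi-identity fails.
module Submission where

open import Defs
open import Level using (Level; Lift; lift)
open import Relation.Nullary using (¬_)

open import Algebra.Lattice.Structures using (IsDistributiveLattice)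
open import Algebra.Morphism.Structures using (module MonoidMorphisms)
open import Data.Bool using (Bool; true; false)
open import Data.Product using (_,_; proj₁; proj₂)
open import Data.Unit.Polymorphic using (⊤; tt)
open import Function using (id)
open import Relation.Binary.Definitions using (DecidableEquality)
open import Relation.Binary.PropositionalEquality
  using (_≡_; refl; cong; cong₂; isEquivalence)
import Relation.Binary.Reasoning.Setoid as ≈-Reasoning
open import Relation.Nullary.Decidable using (Dec; yes; no; map′; _×-dec_; True; toWitness)
open import Relation.Unary using (Pred; Decidable)

module _ {ℓ : Level} (L : SubresiduatedLattice ℓ) where
  private module L = SubresiduatedLattice L
  open SubresiduatedLattice L using (_≈_; _≤_; _∧_; _⇒_; 𝟙)
  open IsDistributiveLattice L.isDistributiveLattice using (∧-cong; ∧-comm)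
  open ≈-Reasoning (Algebra⟨2,0⟩.setoid L.⇒-reduct)

  -- Modus ponens `x∧[x⇒y]≤y`, where the implication is now the unit of `∧` and drops out.
  x⇒y≈𝟙→x≤y : ∀ {x y} → x ⇒ y ≈ 𝟙 → x ≤ y
  x⇒y≈𝟙→x≤y {x} {y} x⇒y≈𝟙 = begin
    x                  ≈⟨ x∧[x⇒y]≈x ⟨
    x ∧ (x ⇒ y)        ≈⟨ L.x∧[x⇒y]≤y x y ⟩
    (x ∧ (x ⇒ y)) ∧ y  ≈⟨ ∧-cong x∧[x⇒y]≈x L.refl ⟩
    x ∧ y              ∎
    where
    x∧[x⇒y]≈x : x ∧ (x ⇒ y) ≈ x
    x∧[x⇒y]≈x = L.trans (∧-cong L.refl x⇒y≈𝟙) (proj₂ L.∧-identity x)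

  ⇒-antisym : ∀ {x y} → x ⇒ y ≈ 𝟙 → y ⇒ x ≈ 𝟙 → x ≈ y
  ⇒-antisym {x} {y} x⇒y≈𝟙 y⇒x≈𝟙 = begin
    x      ≈⟨ x⇒y≈𝟙→x≤y x⇒y≈𝟙 ⟩
    x ∧ y  ≈⟨ ∧-comm x y ⟩
    y ∧ x  ≈⟨ x⇒y≈𝟙→x≤y y⇒x≈𝟙 ⟨
    y      ∎

module _ {ℓ : Level} {A : Algebra⟨2,0⟩ ℓ} where
  open Algebra⟨2,0⟩ A

  -- Quasi-identities pass from `L` to subalgebras and then along isomorphisms: pull `x` and `y`
  -- back by surjectivity, apply `⇒-antisym` in `L`, and map the result forward.
  subreduct-antisym : IsSubreduct A → ∀ {x y} → x ⇒ y ≈ 𝟙 → y ⇒ x ≈ 𝟙 → x ≈ y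
  subreduct-antisym (L , S , f , f-iso) {x} {y} x⇒y≈𝟙 y⇒x≈𝟙 =
    let (a , fa≈) = surjective x
        (b , fb≈) = surjective y
        -- Surjectivity speaks of every element equal to the chosen preimage; here it is used at the
        -- preimage itself.
        fa≈x = fa≈ L.refl
        fb≈y = fb≈ L.refl
    in begin
      x    ≈⟨ fa≈x ⟨
      f a  ≈⟨ ⟦⟧-cong (⇒-antisym L (reflects-𝟙 a b fa≈x fb≈y x⇒y≈𝟙)
                                   (reflects-𝟙 b a fb≈y fa≈x y⇒x≈𝟙)) ⟩
      f b  ≈⟨ fb≈y ⟩
      y    ∎
    where
    module L = SubresiduatedLattice L
    module B = Algebra⟨2,0⟩ (subalgebra L.⇒-reduct (⇒-Subuniverse.subuniverse S))
    open MonoidMorphisms.IsMonoidIsomorphism f-iso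
      using (surjective; injective; homo; ε-homo; ⟦⟧-cong)
    open ≈-Reasoning setoid

    -- By injectivity it suffices to compare images under `f`, where the hypothesis on `u` and `v`
    -- applies. It is used for both orders of the pair.
    reflects-𝟙 : ∀ a b {u v} → f a ≈ u → f b ≈ v → u ⇒ v ≈ 𝟙 → a B.⇒ b B.≈ B.𝟙
    reflects-𝟙 a b {u} {v} fa≈u fb≈v u⇒v≈𝟙 = injective (begin
      f (a B.⇒ b)  ≈⟨ homo a b ⟩
      f a ⇒ f b    ≈⟨ ⇒-cong fa≈u fb≈v ⟩
      u ⇒ v        ≈⟨ u⇒v≈𝟙 ⟩
      𝟙            ≈⟨ ε-homo ⟨
      f B.𝟙        ∎)

module _ (ℓ : Level) where

  data Chain : Set ℓ where
    bot mid top : Chain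

  _≟_ : DecidableEquality Chain
  bot ≟ bot = yes refl
  bot ≟ mid = no λ ()
  bot ≟ top = no λ ()
  mid ≟ bot = no λ ()
  mid ≟ mid = yes refl
  mid ≟ top = no λ ()
  top ≟ bot = no λ ()
  top ≟ mid = no λ ()
  top ≟ top = yes refl

  -- Quantification over three elements is decidable, so every identity of the chain can be checked
  -- by evaluation.
  all? : ∀ {p} {P : Pred Chain p} → Decidable P → Dec (∀ x → P x)
  all? P? = map′
    (λ { (pb , pm , pt) → λ { bot → pb ; mid → pm ; top → pt } })
    (λ p → p bot , p mid , p top)
    (P? bot ×-dec P? mid ×-dec P? top)

  _∧_ _∨_ _⇒_ : Chain → Chain → Chain
  bot ∧ y   = bot
  mid ∧ bot = bot
  mid ∧ mid = mid
  mid ∧ top = mid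
  top ∧ y   = y

  bot ∨ y   = y
  mid ∨ bot = mid
  mid ∨ mid = mid
  mid ∨ top = top
  top ∨ y   = top

  -- `x ⇒ y` is the largest `d` in the sublattice of `bot` and `top` with `x ∧ d` below `y`.
  bot ⇒ y   = top
  mid ⇒ bot = bot
  mid ⇒ mid = top
  mid ⇒ top = top
  top ⇒ bot = bot
  top ⇒ mid = bot
  top ⇒ top = top

  -- For a valid identity the decision evaluates to `yes`, so the implicit argument has a unit type
  -- and is filled in automatically. The same holds for `law₂` and `law₃`.
  law₁ : (s t : Chain → Chain) →
         {True (all? λ x → s x ≟ t x)} → ∀ x → s x ≡ t x
  law₁ s t {p} = toWitness p

  law₂ : (s t : Chain → Chain → Chain) →
         {True (all? λ x → all? λ y → s x y ≟ t x y)} → ∀ x y → s x y ≡ t x y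
  law₂ s t {p} = toWitness p

  law₃ : (s t : Chain → Chain → Chain → Chain) →
         {True (all? λ x → all? λ y → all? λ z → s x y z ≟ t x y z)} →
         ∀ x y z → s x y z ≡ t x y z
  law₃ s t {p} = toWitness p

  chain : SubresiduatedLattice ℓ
  chain = record
    { Carrier = Chain
    ; _≈_ = _≡_
    ; _∧_ = _∧_
    ; _∨_ = _∨_
    ; _⇒_ = _⇒_
    ; 𝟘 = bot
    ; 𝟙 = top
    ; isDistributiveLattice = record
      { isLattice = record
        { isEquivalence = isEquivalence
        ; ∨-comm  = law₂ (λ x y → x ∨ y) (λ x y → y ∨ x)
        ; ∨-assoc = law₃ (λ x y z → (x ∨ y) ∨ z) (λ x y z → x ∨ (y ∨ z))
        ; ∨-cong  = cong₂ _∨_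
        ; ∧-comm  = law₂ (λ x y → x ∧ y) (λ x y → y ∧ x)
        ; ∧-assoc = law₃ (λ x y z → (x ∧ y) ∧ z) (λ x y z → x ∧ (y ∧ z))
        ; ∧-cong  = cong₂ _∧_
        ; absorptive =
            law₂ (λ x y → x ∨ (x ∧ y)) (λ x y → x) ,
            law₂ (λ x y → x ∧ (x ∨ y)) (λ x y → x)
        }
      ; ∨-distrib-∧ =
          law₃ (λ x y z → x ∨ (y ∧ z)) (λ x y z → (x ∨ y) ∧ (x ∨ z)) ,
          law₃ (λ x y z → (y ∧ z) ∨ x) (λ x y z → (y ∨ x) ∧ (z ∨ x))
      ; ∧-distrib-∨ =
          law₃ (λ x y z → x ∧ (y ∨ z)) (λ x y z → (x ∧ y) ∨ (x ∧ z)) ,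
          law₃ (λ x y z → (y ∨ z) ∧ x) (λ x y z → (y ∧ x) ∨ (z ∧ x))
      }
    ; ∨-identity = (λ _ → refl) , law₁ (λ x → x ∨ bot) id
    ; ∧-identity = (λ _ → refl) , law₁ (λ x → x ∧ top) id
    ; ⇒-cong = cong₂ _⇒_
    ; x⇒x≈𝟙 = law₁ (λ x → x ⇒ x) (λ x → top)
    -- Since `x ≤ y` unfolds to `x ≈ x ∧ y`, the inequalities are identities as well.
    ; x⇒y≤z⇒[x⇒y] = law₃ (λ x y z → x ⇒ y) (λ x y z → (x ⇒ y) ∧ (z ⇒ (x ⇒ y)))
    ; x∧[x⇒y]≤y = law₂ (λ x y → x ∧ (x ⇒ y)) (λ x y → (x ∧ (x ⇒ y)) ∧ y)
    ; ⇒-distribˡ-∧ = law₃ (λ x y z → z ⇒ (x ∧ y)) (λ x y z → (z ⇒ x) ∧ (z ⇒ y))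
    ; ⇒-distribʳ-∨ = law₃ (λ x y z → (x ∨ y) ⇒ z) (λ x y z → (x ⇒ z) ∧ (y ⇒ z))
    ; ⇒-trans = law₃ (λ x y z → (x ⇒ y) ∧ (y ⇒ z))
                     (λ x y z → ((x ⇒ y) ∧ (y ⇒ z)) ∧ (x ⇒ z))
    }

  allChain : ⇒-Subuniverse chain
  allChain = record
    { member   = λ _ → ⊤
    ; resp     = λ _ _ → tt
    ; nonempty = top , tt
    ; ⇒-closed = λ _ _ → tt
    }

  -- Taken as the subalgebra on all elements, so that the identity map witnesses `IsSubreduct`.
  chainReduct : Algebra⟨2,0⟩ ℓ
  chainReduct = subalgebra (SubresiduatedLattice.⇒-reduct chain)
                           (⇒-Subuniverse.subuniverse allChain)

  chainReduct-isSubreduct : IsSubreduct chainReduct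
  chainReduct-isSubreduct = chain , allChain , id , record
    { isMonoidMonomorphism = record
      { isMonoidHomomorphism = record
        { isMagmaHomomorphism = record
          { isRelHomomorphism = record { cong = id }
          ; homo = λ _ _ → refl
          }
        ; ε-homo = refl
        }
      ; injective = id
      }
    ; surjective = λ y → y , id
    }

  -- The quotient of the chain: `lift true` is the class of `bot` and `top`, `lift false` that of
  -- `mid`.
  constant-⇒ : Algebra⟨2,0⟩ ℓ
  constant-⇒ = record
    { Carrier = Lift ℓ Bool
    ; _≈_     = _≡_
    ; _⇒_     = λ _ _ → lift true
    ; 𝟙       = lift true
    ; isMagma = record { isEquivalence = isEquivalence ; ∙-cong = λ _ _ → refl }
    }

  collapse : Chain → Lift ℓ Bool
  collapse bot = lift true
  collapse mid = lift false
  collapse top = lift true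

  collapse-⇒ : ∀ x y → collapse (x ⇒ y) ≡ lift true
  collapse-⇒ bot _   = refl
  collapse-⇒ mid bot = refl
  collapse-⇒ mid mid = refl
  collapse-⇒ mid top = refl
  collapse-⇒ top bot = refl
  collapse-⇒ top mid = refl
  collapse-⇒ top top = refl

  collapse-image : HomomorphicImage chainReduct constant-⇒
  collapse-image = (λ x → collapse (proj₁ x)) , record
    { isMagmaHomomorphism = record
      { isRelHomomorphism = record { cong = cong collapse }
      ; homo = λ x y → collapse-⇒ (proj₁ x) (proj₁ y)
      }
    ; ε-homo = refl
    } , λ { (lift true)  → (top , tt) , cong collapse
          ; (lift false) → (mid , tt) , cong collapse
          }

  constant-⇒-notSubreduct : ¬ IsSubreduct constant-⇒
  constant-⇒-notSubreduct K
    -- Both implications between the two elements compute to `lift true`, so antisymmetry would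
    -- equate `lift true` with `lift false`.
    with () ← subreduct-antisym {A = constant-⇒} K {lift true} {lift false} refl refl

lemma3p1 : (ℓ : Level) → ¬ IsVariety (IsSubreduct {ℓ})
lemma3p1 ℓ V = constant-⇒-notSubreduct ℓ
  (IsVariety.H-closed V {chainReduct ℓ} {constant-⇒ ℓ}
    (collapse-image ℓ) (chainReduct-isSubreduct ℓ))
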